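{- Assume that there is a $1$-perfect code in $H(q+1,q)$. Let $f$ be a $(b,c)$-coloring of $H(n,q)$ with main eigenvalue $\lambda\le 0$. Then for all $t_1,t_2\in\{0,\dots,q\}$ with $t_1+t_2\notin\{0,2q\}$ there exists a $(q(b+c)-(ct_1+bt_2),\ ct_1+bt_2)$-coloring $F$ of $H(qn-\lambda,q)$. Moreover, $F$ has main eigenvalue $\lambda$.
   Context: $H(n,q)$: vertex set $\mathbb{Z}_q^n$, two vertices adjacent iff they differ in exactly one coordinate. A $(b,c)$-coloring of $H(N,q)$ is a surjective map from the vertices onto $\{1,2\}$ such that every vertex of color $1$ has exactly $b$ neighbors of color $2$ and every vertex of color $2$ has exactly $c$ neighbors of color $1$; its main eigenvalue is $N(q-1)-(b+c)$. A $1$-perfect code in $H(N,q)$ is a vertex set $C$ such that every Hamming ball of radius $1$ contains exactly one element of $C$. -}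

module Defs where

open import Data.Nat using (ℕ; _≤_)
open import Data.Fin using (Fin; zero; suc)
open import Data.Fin.Properties using (_≟_)
open import Data.Vec using (Vec; lookup; _[_]≔_; zipWith; toList)
open import Data.List using (List; concatMap; map; filter; allFin; length)
open import Data.Bool using (Bool; true; false)
open import Data.Product using (Σ; _×_; ∃)
open import Data.Integer using (ℤ; +_; _-_; _*_; 1ℤ)
open import Relation.Nullary using (¬_)
open import Relation.Nullary.Decidable using (¬?)
open import Relation.Binary.PropositionalEquality using (_≡_; _≢_)

Vertex : ℕ → ℕ → Set
Vertex n q = Vec (Fin q) n

dist : ∀ {n q} → Vertex n q → Vertex n q → ℕ
dist {n} x y = length (filter (λ i → ¬? (lookup x i ≟ lookup y i)) (allFin n))

neighbours : ∀ {n q} → Vertex n q → List (Vertex n q)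
neighbours {n} {q} x =
  concatMap (λ i → map (λ a → x [ i ]≔ a)
                       (filter (λ a → ¬? (a ≟ lookup x i)) (allFin q)))
            (allFin n)

colour1 colour2 : Fin 2
colour1 = zero
colour2 = suc zero

nbrsOfColour : ∀ {n q} → (Vertex n q → Fin 2) → Fin 2 → Vertex n q → ℕ
nbrsOfColour f k x = length (filter (λ y → f y ≟ k) (neighbours x))

record IsColouring (n q b c : ℕ) (f : Vertex n q → Fin 2) : Set where
  field
    surj   : ∀ k → ∃ λ x → f x ≡ k
    col1   : ∀ x → f x ≡ colour1 → nbrsOfColour f colour2 x ≡ b
    col2   : ∀ x → f x ≡ colour2 → nbrsOfColour f colour1 x ≡ c

mainEigenvalue : ℕ → ℕ → ℕ → ℕ → ℤ
mainEigenvalue N q b c = (+ N) * (+ q - 1ℤ) - (+ (b Data.Nat.+ c))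
  where import Data.Nat

IsPerfectCode : ∀ n q → (Vertex n q → Set) → Set
IsPerfectCode n q C =
  ∀ x → Σ (Vertex n q) λ y → C y × dist x y ≤ 1 ×
        (∀ z → C z → dist x z ≤ 1 → z ≡ y)

{-# OPTIONS --safe #-}
-- Write q = p + 1.  A 1-perfect code in H(q+1, q) is the graph of a map w ↦ (Λ(w), U(w)) on Z_q^p.
-- Fixing a Latin square ∗, the pair (π, ℓ)(u, w) = (u ∗ U(w), Λ(w)) on Z_q^q then has the property that
-- for every x and every s ≠ π(x) the q neighbours of x with π = s carry each label once, while no
-- neighbour of x has π = π(x).  Cut the N = nq − λ coordinates into n blocks of length q and −λ single
-- ones; π maps a vertex X to y ∈ Z_q^n, and the ∗-combination of the block labels and of the single
-- coordinates gives X a label.  The 2q classes {f(y) = j, label = l} form an equitable partition in which a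
-- vertex outside a class has c (for j = 1) or b (for j = 2) neighbours in it, so merging t₁ of the
-- classes with j = 1 and t₂ of those with j = 2 into the first colour gives F.
module Submission where

open import Defs
open import Data.Nat using (ℕ; zero; suc; _≤_; _<_; _+_; _*_; _∸_; z≤n; s≤s; _≤?_; _<?_)
import Data.Nat as ℕ
open import Data.Nat.Properties hiding (_≟_)
open import Data.Nat.Tactic.RingSolver using (solve-∀)
open import Data.Fin using (Fin; zero; suc; toℕ; fromℕ<)
open import Data.Fin.Properties using (_≟_; any?; toℕ-injective; toℕ-fromℕ<; toℕ<n)
open import Data.Fin.Permutation using (permutation)
open import Data.Vec using ([]; _∷_; _++_; _[_]≔_; lookup; take; drop; replicate)
open import Data.Vec.Properties using (≡-dec; take++drop≡id; []≔-lookup)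
open import Data.List using (List; []; _∷_; length; filter; map; concat; allFin; tabulate)
import Data.List as List
open import Data.List.Properties using (map-tabulate; filter-++; length-++)
open import Data.Bool using (true; false; if_then_else_)
open import Data.Product using (Σ; _×_; ∃; ∃₂; _,_; proj₁; proj₂)
open import Data.Sum using (_⊎_; inj₁; inj₂)
open import Function using (_∘_; id)
open import Relation.Nullary using (Dec; yes; no; does; ¬_; contradiction)
open import Relation.Nullary.Decidable using (¬?; _×-dec_; dec-true; dec-false)
open import Relation.Unary using (Decidable)
open import Relation.Binary.PropositionalEquality using (_≡_; _≢_; refl; sym; trans; cong; cong₂; subst; module ≡-Reasoning)
open import Algebra.Properties.Semiring.Sum +-*-semiring using (sum; sum-syntax; sum-cong-≗; sum-replicate-zero; ∑-distrib-+; ∑-comm; ∑-permute; *-distribˡ-sum; *-distribʳ-sum)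

-- Indicators and finite sums.

𝟙 : ∀ {P : Set} → Dec P → ℕ
𝟙 d = if does d then 1 else 0

𝟙-true : ∀ {P : Set} (d : Dec P) → P → 𝟙 d ≡ 1
𝟙-true (yes _) _ = refl
𝟙-true (no ¬p) p = contradiction p ¬p

𝟙-false : ∀ {P : Set} (d : Dec P) → ¬ P → 𝟙 d ≡ 0
𝟙-false (yes p) ¬p = contradiction p ¬p
𝟙-false (no _) _ = refl

𝟙≤1 : ∀ {P : Set} (d : Dec P) → 𝟙 d ≤ 1
𝟙≤1 (yes _) = ≤-refl
𝟙≤1 (no _) = z≤n

𝟙-cong : ∀ {P Q : Set} (d : Dec P) (e : Dec Q) → (P → Q) → (Q → P) → 𝟙 d ≡ 𝟙 e
𝟙-cong (yes p) e to from = sym (𝟙-true e (to p))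
𝟙-cong (no ¬p) e to from = sym (𝟙-false e (¬p ∘ from))

𝟙-× : ∀ {P Q : Set} (d : Dec P) (e : Dec Q) → 𝟙 (d ×-dec e) ≡ 𝟙 d * 𝟙 e
𝟙-× (yes _) (yes _) = refl
𝟙-× (yes _) (no _) = refl
𝟙-× (no _) e = refl

∑-const : ∀ n k → ∑[ i < n ] k ≡ n * k
∑-const zero k = refl
∑-const (suc n) k = cong (k +_) (∑-const n k)

∑-mono : ∀ n {f g : Fin n → ℕ} → (∀ i → f i ≤ g i) → sum f ≤ sum g
∑-mono zero f≤g = z≤n
∑-mono (suc n) f≤g = +-mono-≤ (f≤g zero) (∑-mono n (f≤g ∘ suc))

∑-zero : ∀ n {f : Fin n → ℕ} → (∀ i → f i ≡ 0) → sum f ≡ 0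
∑-zero n f≡0 = trans (sum-cong-≗ f≡0) (sum-replicate-zero n)

∑-positive : ∀ n (f : Fin n → ℕ) → sum f ≢ 0 → ∃ λ i → f i ≢ 0
∑-positive zero f ≢0 = contradiction refl ≢0
∑-positive (suc n) f ≢0 with f zero in eq
... | suc _ = zero , λ f₀≡0 → contradiction (trans (sym eq) f₀≡0) λ ()
... | zero with ∑-positive n (f ∘ suc) ≢0
...   | i , fᵢ≢0 = suc i , fᵢ≢0

∑-select : ∀ {n} (b : Fin n) (g : Fin n → ℕ) → ∑[ a < n ] (𝟙 (a ≟ b) * g a) ≡ g b
∑-select {suc n} zero g =
  trans (cong₂ _+_ (+-identityʳ (g zero)) (∑-zero n λ _ → refl)) (+-identityʳ (g zero))
∑-select {suc n} (suc b) g = ∑-select b (g ∘ suc)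

∑-𝟙 : ∀ {n} (b : Fin n) → ∑[ a < n ] 𝟙 (a ≟ b) ≡ 1
∑-𝟙 b = trans (sum-cong-≗ λ a → sym (*-identityʳ (𝟙 (a ≟ b)))) (∑-select b (λ _ → 1))

-- Sums over the lines through a vertex.

private
  variable
    q n m : ℕ

-- The point x itself is counted once for each coordinate.
lineSum : (Vertex n q → ℕ) → Vertex n q → ℕ
lineSum {n} {q} g x = ∑[ i < n ] ∑[ a < q ] g (x [ i ]≔ a)

lineSum-cong : {g h : Vertex n q → ℕ} → (∀ v → g v ≡ h v) → ∀ x → lineSum g x ≡ lineSum h x
lineSum-cong g≡h x = sum-cong-≗ λ i → sum-cong-≗ λ a → g≡h (x [ i ]≔ a)

lineSum-+ : (g h : Vertex n q → ℕ) → ∀ x →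
  lineSum (λ v → g v + h v) x ≡ lineSum g x + lineSum h x
lineSum-+ {n} {q} g h x = trans
  (sum-cong-≗ λ i → ∑-distrib-+ (λ a → g (x [ i ]≔ a)) (λ a → h (x [ i ]≔ a)))
  (∑-distrib-+ (λ i → ∑[ a < q ] g (x [ i ]≔ a)) (λ i → ∑[ a < q ] h (x [ i ]≔ a)))

lineSum-*ʳ : (g : Vertex n q → ℕ) (k : ℕ) → ∀ x → lineSum (λ v → g v * k) x ≡ lineSum g x * k
lineSum-*ʳ {n} {q} g k x = sym (trans
  (*-distribʳ-sum k (λ i → ∑[ a < q ] g (x [ i ]≔ a)))
  (sum-cong-≗ λ i → *-distribʳ-sum k (λ a → g (x [ i ]≔ a))))

lineSum-const : (k : ℕ) (x : Vertex n q) → lineSum (λ _ → k) x ≡ n * (q * k)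
lineSum-const {n} {q} k x = trans (sum-cong-≗ {n} λ _ → ∑-const q k) (∑-const n (q * k))

lineSum-∑ : (g : Fin m → Vertex n q → ℕ) → ∀ x →
  lineSum (λ v → ∑[ j < m ] g j v) x ≡ ∑[ j < m ] lineSum (g j) x
lineSum-∑ {m} {n} {q} g x = trans
  (sum-cong-≗ λ i → ∑-comm (λ a j → g j (x [ i ]≔ a)))
  (∑-comm (λ i j → ∑[ a < q ] g j (x [ i ]≔ a)))

lineSum-++ : (h : Vertex (m + n) q → ℕ) (x : Vertex m q) (r : Vertex n q) →
  lineSum h (x ++ r) ≡ lineSum (λ x′ → h (x′ ++ r)) x + lineSum (λ r′ → h (x ++ r′)) r
lineSum-++ h [] r = refl
lineSum-++ {q = q} h (u ∷ x) r = trans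
  (cong (∑[ a < q ] h (a ∷ x ++ r) +_) (lineSum-++ (h ∘ (u ∷_)) x r))
  (sym (+-assoc (∑[ a < q ] h (a ∷ x ++ r)) _ _))

lineSum-positive : (g : Vertex n q → ℕ) (x : Vertex n q) → lineSum g x ≢ 0 → ∃ λ v → g v ≢ 0
lineSum-positive {n} {q} g x ≢0 with ∑-positive n _ ≢0
... | i , ≢0′ with ∑-positive q _ ≢0′
...   | a , g≢0 = x [ i ]≔ a , g≢0

-- Neighbour counts as line sums.

length-filter-tabulate : ∀ {A : Set} {P : A → Set} (P? : Decidable P) (f : Fin n → A) →
  length (filter P? (tabulate f)) ≡ ∑[ i < n ] 𝟙 (P? (f i))
length-filter-tabulate {zero} P? f = refl
length-filter-tabulate {suc n} P? f with does (P? (f zero))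
... | true = cong suc (length-filter-tabulate P? (f ∘ suc))
... | false = length-filter-tabulate P? (f ∘ suc)

length-filter-concat-tabulate : ∀ {A : Set} {P : A → Set} (P? : Decidable P) (f : Fin n → List A) →
  length (filter P? (concat (tabulate f))) ≡ ∑[ i < n ] length (filter P? (f i))
length-filter-concat-tabulate {zero} P? f = refl
length-filter-concat-tabulate {suc n} P? f = begin
  length (filter P? (f zero List.++ concat (tabulate (f ∘ suc))))
    ≡⟨ cong length (filter-++ P? (f zero) _) ⟩
  length (filter P? (f zero) List.++ filter P? (concat (tabulate (f ∘ suc))))
    ≡⟨ length-++ (filter P? (f zero)) ⟩
  length (filter P? (f zero)) + length (filter P? (concat (tabulate (f ∘ suc))))
    ≡⟨ cong (length (filter P? (f zero)) +_) (length-filter-concat-tabulate P? (f ∘ suc)) ⟩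
  length (filter P? (f zero)) + ∑[ i < n ] length (filter P? (f (suc i))) ∎
  where open ≡-Reasoning

-- Everything that `Q?` removes would fail `P?` after `f` anyway.
length-filter-map-filter : ∀ {A B : Set} {P : B → Set} {Q : A → Set} (P? : Decidable P) (Q? : Decidable Q)
  (f : A → B) → (∀ a → P (f a) → Q a) → (xs : List A) →
  length (filter P? (map f (filter Q? xs))) ≡ length (filter (P? ∘ f) xs)
length-filter-map-filter P? Q? f P⇒Q [] = refl
length-filter-map-filter P? Q? f P⇒Q (x ∷ xs) with Q? x
length-filter-map-filter P? Q? f P⇒Q (x ∷ xs) | yes _ with does (P? (f x))
... | true = cong suc (length-filter-map-filter P? Q? f P⇒Q xs)
... | false = length-filter-map-filter P? Q? f P⇒Q xs
length-filter-map-filter P? Q? f P⇒Q (x ∷ xs) | no ¬q with P? (f x)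
... | yes p = contradiction (P⇒Q x p) ¬q
... | no _ = length-filter-map-filter P? Q? f P⇒Q xs

-- A line sum counts `x` once per coordinate, while `neighbours` omits it; since `x` does not have
-- colour `k`, these extra terms are zero.
nbrsOfColour≡lineSum : (f : Vertex n q → Fin 2) (k : Fin 2) (x : Vertex n q) → f x ≢ k →
  nbrsOfColour f k x ≡ lineSum (λ v → 𝟙 (f v ≟ k)) x
nbrsOfColour≡lineSum {n} {q} f k x fx≢k = begin
  length (filter k? (concat (map line (allFin n))))
    ≡⟨ cong (λ ls → length (filter k? (concat ls))) (map-tabulate id line) ⟩
  length (filter k? (concat (tabulate line)))
    ≡⟨ length-filter-concat-tabulate k? line ⟩
  ∑[ i < n ] length (filter k? (line i))
    ≡⟨ sum-cong-≗ (λ i → trans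
         (length-filter-map-filter k? (λ a → ¬? (a ≟ lookup x i)) (λ a → x [ i ]≔ a) (moved i) (allFin q))
         (length-filter-tabulate (λ a → k? (x [ i ]≔ a)) id)) ⟩
  lineSum (λ v → 𝟙 (f v ≟ k)) x ∎
  where
  open ≡-Reasoning
  k? : Decidable (λ v → f v ≡ k)
  k? v = f v ≟ k
  line : Fin n → List (Vertex n q)
  line i = map (λ a → x [ i ]≔ a) (filter (λ a → ¬? (a ≟ lookup x i)) (allFin q))
  moved : ∀ i a → f (x [ i ]≔ a) ≡ k → a ≢ lookup x i
  moved i a fx≡k refl = fx≢k (trans (sym (cong f ([]≔-lookup x i))) fx≡k)

-- Hamming distance and balls of radius 1.

dist-∷ : ∀ (u v : Fin q) (x y : Vertex n q) → dist (u ∷ x) (v ∷ y) ≡ 𝟙 (¬? (u ≟ v)) + dist x y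
dist-∷ {n = n} u v x y = trans
  (length-filter-tabulate (λ i → ¬? (lookup (u ∷ x) i ≟ lookup (v ∷ y) i)) id)
  (cong (𝟙 (¬? (u ≟ v)) +_)
    (sym (length-filter-tabulate (λ i → ¬? (lookup x i ≟ lookup y i)) id)))

dist-refl : (x : Vertex n q) → dist x x ≡ 0
dist-refl [] = refl
dist-refl (u ∷ x) = trans (dist-∷ u u x x)
  (cong₂ _+_ (𝟙-false (¬? (u ≟ u)) (contradiction refl)) (dist-refl x))

dist-[]≔ : (x : Vertex n q) (i : Fin n) (a : Fin q) → dist x (x [ i ]≔ a) ≤ 1
dist-[]≔ (u ∷ x) zero a = begin
  dist (u ∷ x) (a ∷ x)          ≡⟨ dist-∷ u a x x ⟩
  𝟙 (¬? (u ≟ a)) + dist x x     ≡⟨ cong (𝟙 (¬? (u ≟ a)) +_) (dist-refl x) ⟩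
  𝟙 (¬? (u ≟ a)) + 0            ≡⟨ +-identityʳ _ ⟩
  𝟙 (¬? (u ≟ a))                ≤⟨ 𝟙≤1 (¬? (u ≟ a)) ⟩
  1                             ∎
  where open ≤-Reasoning
dist-[]≔ (u ∷ x) (suc i) a = begin
  dist (u ∷ x) (u ∷ x [ i ]≔ a)             ≡⟨ dist-∷ u u x _ ⟩
  𝟙 (¬? (u ≟ u)) + dist x (x [ i ]≔ a)      ≡⟨ cong (_+ dist x (x [ i ]≔ a)) (𝟙-false (¬? (u ≟ u)) (contradiction refl)) ⟩
  dist x (x [ i ]≔ a)                       ≤⟨ dist-[]≔ x i a ⟩
  1                                         ∎
  where open ≤-Reasoning

dist≡0⇒≡ : (x y : Vertex n q) → dist x y ≡ 0 → x ≡ y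
dist≡0⇒≡ [] [] _ = refl
dist≡0⇒≡ (u ∷ x) (v ∷ y) d≡0 with u ≟ v | dist-∷ u v x y
... | yes refl | eq = cong (u ∷_) (dist≡0⇒≡ x y (trans (sym eq) d≡0))
... | no _ | eq = contradiction (trans (sym d≡0) eq) λ ()

_≟ᵥ_ : (x y : Vertex n q) → Dec (x ≡ y)
_≟ᵥ_ = ≡-dec _≟_

-- A point at distance 1 from x lies on one line through x, and x itself on all n of them.
lineSum-point : (x y : Vertex n q) → dist x y ≤ 1 →
  lineSum (λ v → 𝟙 (v ≟ᵥ y)) x + 𝟙 (x ≟ᵥ y) ≡ 1 + n * 𝟙 (x ≟ᵥ y)
lineSum-point [] [] _ = refl
lineSum-point {suc n} {q} (u ∷ x) (v ∷ y) d≤1 = begin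
  ∑[ a < q ] 𝟙 ((a ∷ x) ≟ᵥ (v ∷ y)) + lineSum (λ z → 𝟙 ((u ∷ z) ≟ᵥ (v ∷ y))) x + 𝟙 ((u ∷ x) ≟ᵥ (v ∷ y))
    ≡⟨ cong₂ _+_ (cong₂ _+_
         (trans (sum-cong-≗ λ a → 𝟙-× (a ≟ v) (x ≟ᵥ y)) (∑-select v (λ _ → 𝟙 (x ≟ᵥ y))))
         (trans (lineSum-cong (λ z → trans (𝟙-× (u ≟ v) (z ≟ᵥ y)) (*-comm (𝟙 (u ≟ v)) _)) x)
                (lineSum-*ʳ (λ z → 𝟙 (z ≟ᵥ y)) (𝟙 (u ≟ v)) x)))
         (𝟙-× (u ≟ v) (x ≟ᵥ y)) ⟩
  𝟙 (x ≟ᵥ y) + e * 𝟙 (u ≟ v) + 𝟙 (u ≟ v) * 𝟙 (x ≟ᵥ y)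
    ≡⟨ cases (u ≟ v) ⟩
  1 + suc n * (𝟙 (u ≟ v) * 𝟙 (x ≟ᵥ y))
    ≡⟨ cong (λ k → 1 + suc n * k) (𝟙-× (u ≟ v) (x ≟ᵥ y)) ⟨
  1 + suc n * 𝟙 ((u ∷ x) ≟ᵥ (v ∷ y)) ∎
  where
  open ≡-Reasoning
  e = lineSum (λ z → 𝟙 (z ≟ᵥ y)) x
  d′ : 𝟙 (¬? (u ≟ v)) + dist x y ≤ 1
  d′ = subst (_≤ 1) (dist-∷ u v x y) d≤1
  cases : (d : Dec (u ≡ v)) →
    𝟙 (x ≟ᵥ y) + e * 𝟙 d + 𝟙 d * 𝟙 (x ≟ᵥ y) ≡ 1 + suc n * (𝟙 d * 𝟙 (x ≟ᵥ y))
  cases (yes u≡v) = begin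
    𝟙 (x ≟ᵥ y) + e * 1 + 1 * 𝟙 (x ≟ᵥ y)
      ≡⟨ rearrange (𝟙 (x ≟ᵥ y)) e ⟩
    𝟙 (x ≟ᵥ y) + (e + 𝟙 (x ≟ᵥ y))
      ≡⟨ cong (𝟙 (x ≟ᵥ y) +_) (lineSum-point x y (≤-trans (m≤n+m _ _) d′)) ⟩
    𝟙 (x ≟ᵥ y) + (1 + n * 𝟙 (x ≟ᵥ y))
      ≡⟨ rearrange′ (𝟙 (x ≟ᵥ y)) n ⟩
    1 + suc n * (1 * 𝟙 (x ≟ᵥ y)) ∎
    where
    rearrange : ∀ i j → i + j * 1 + 1 * i ≡ i + (j + i)
    rearrange = solve-∀
    rearrange′ : ∀ i j → i + (1 + j * i) ≡ 1 + (1 + j) * (1 * i)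
    rearrange′ = solve-∀
  cases (no u≢v) = subst (λ k → k + e * 0 + 0 * k ≡ 1 + suc n * (0 * k))
    (sym (𝟙-true (x ≟ᵥ y) x≡y)) (rearrange e n)
    where
    x≡y : x ≡ y
    x≡y = dist≡0⇒≡ x y (n≤0⇒n≡0 (+-cancelˡ-≤ 1 _ _ (subst (λ k → k + dist x y ≤ 1) (𝟙-true (¬? (u ≟ v)) u≢v) d′)))
    rearrange : ∀ i j → 1 + i * 0 + 0 * 1 ≡ 1 + (1 + j) * (0 * 1)
    rearrange = solve-∀

-- Perfect codes in general.

module _ {C : Vertex n q → Set} (perfect : IsPerfectCode n q C) where

  decode : Vertex n q → Vertex n q
  decode v = proj₁ (perfect v)

  decode-∈ : ∀ v → C (decode v)
  decode-∈ v = proj₁ (proj₂ (perfect v))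

  decode-unique : ∀ v {z} → C z → dist v z ≤ 1 → z ≡ decode v
  decode-unique v {z} = proj₂ (proj₂ (proj₂ (perfect v))) z

  decode-fixed : ∀ {v} → C v → decode v ≡ v
  decode-fixed {v} v∈C = sym (decode-unique v v∈C (subst (_≤ 1) (sym (dist-refl v)) z≤n))

  fixed-∈ : ∀ {v} → decode v ≡ v → C v
  fixed-∈ {v} eq = subst C eq (decode-∈ v)

  -- `C` comes without a decision procedure. Its members are exactly the fixed points of `decode`,
  -- and equality of vertices is decidable, so this is the indicator of `C`.
  χ : Vertex n q → ℕ
  χ v = 𝟙 (decode v ≟ᵥ v)

  -- Every point on a line through `v` is in the ball around `v`, where `decode v` is the only
  -- codeword. So `χ` can be replaced there by the indicator of that point, and `lineSum-point`
  -- applies.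
  lineSum-χ : ∀ v → lineSum χ v + χ v ≡ 1 + n * χ v
  lineSum-χ v = begin
    lineSum χ v + χ v
      ≡⟨ cong₂ _+_
           (sum-cong-≗ λ i → sum-cong-≗ λ a → χ≡point (v [ i ]≔ a) (dist-[]≔ v i a))
           χv≡point ⟩
    lineSum (λ z → 𝟙 (z ≟ᵥ decode v)) v + 𝟙 (v ≟ᵥ decode v)
      ≡⟨ lineSum-point v (decode v) (proj₁ (proj₂ (proj₂ (perfect v)))) ⟩
    1 + n * 𝟙 (v ≟ᵥ decode v)
      ≡⟨ cong (λ k → 1 + n * k) χv≡point ⟨
    1 + n * χ v ∎
    where
    open ≡-Reasoning
    χ≡point : ∀ z → dist v z ≤ 1 → χ z ≡ 𝟙 (z ≟ᵥ decode v)
    χ≡point z d≤1 = 𝟙-cong (decode z ≟ᵥ z) (z ≟ᵥ decode v)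
      (λ eq → decode-unique v (fixed-∈ eq) d≤1)
      (λ z≡ → decode-fixed (subst C (sym z≡) (decode-∈ v)))
    χv≡point : χ v ≡ 𝟙 (v ≟ᵥ decode v)
    χv≡point = 𝟙-cong (decode v ≟ᵥ v) (v ≟ᵥ decode v) sym sym

-- Perfect codes in H(q+1, q) as graphs of maps.

graph : ∀ {p} (U Λ : Vertex p q → Fin q) → Vertex (2 + p) q → ℕ
graph U Λ (l ∷ u ∷ w) = 𝟙 (u ≟ U w) * 𝟙 (l ≟ Λ w)

∑∑-graph : ∀ {p} (U Λ : Vertex p q → Fin q) (w : Vertex p q) →
  ∑[ l < q ] ∑[ u < q ] graph U Λ (l ∷ u ∷ w) ≡ 1
∑∑-graph {q} U Λ w =
  trans (sum-cong-≗ λ l → ∑-select (U w) (λ _ → 𝟙 (l ≟ Λ w))) (∑-𝟙 (Λ w))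

module _ {p : ℕ} {C : Vertex (2 + p) (1 + p) → Set} (perfect : IsPerfectCode (2 + p) (1 + p) C) where

  private
    q′ = 1 + p

    Codeword : Vertex p q′ → Set
    Codeword w = ∃₂ λ l u → decode perfect (l ∷ u ∷ w) ≡ l ∷ u ∷ w

    codeword? : ∀ w → Dec (Codeword w)
    codeword? w = any? λ l → any? λ u → decode perfect (l ∷ u ∷ w) ≟ᵥ (l ∷ u ∷ w)

    weight : Vertex p q′ → ℕ
    weight w = ∑[ l < q′ ] ∑[ u < q′ ] χ perfect (l ∷ u ∷ w)

    lineSum-χ′ : ∀ v → lineSum (χ perfect) v ≡ 1 + q′ * χ perfect v
    lineSum-χ′ v = +-cancelʳ-≡ (χ perfect v) _ _
      (trans (lineSum-χ perfect v) (cong suc (+-comm (χ perfect v) (q′ * χ perfect v))))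

    -- Both codewords lie within distance 1 of (l , u′ , w).
    codeword-unique : ∀ {w l u l′ u′} → C (l ∷ u ∷ w) → C (l′ ∷ u′ ∷ w) →
      l ∷ u ∷ w ≡ l′ ∷ u′ ∷ w
    codeword-unique {w} {l} {u} {l′} {u′} c c′ = trans
      (decode-unique perfect (l ∷ u′ ∷ w) c (dist-[]≔ (l ∷ u′ ∷ w) (suc zero) u))
      (sym (decode-unique perfect (l ∷ u′ ∷ w) c′ (dist-[]≔ (l ∷ u′ ∷ w) zero l′)))

    χ-codeword : ∀ {w l₀ u₀} → decode perfect (l₀ ∷ u₀ ∷ w) ≡ l₀ ∷ u₀ ∷ w →
      ∀ l u → χ perfect (l ∷ u ∷ w) ≡ 𝟙 (u ≟ u₀) * 𝟙 (l ≟ l₀)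
    χ-codeword {w} {l₀} {u₀} eq l u = trans
      (𝟙-cong (decode perfect (l ∷ u ∷ w) ≟ᵥ (l ∷ u ∷ w)) (u ≟ u₀ ×-dec l ≟ l₀)
        (λ eq′ → split (codeword-unique (fixed-∈ perfect eq′) (fixed-∈ perfect eq)))
        (λ { (refl , refl) → eq }))
      (𝟙-× (u ≟ u₀) (l ≟ l₀))
      where
      split : ∀ {l u} → l ∷ u ∷ w ≡ l₀ ∷ u₀ ∷ w → u ≡ u₀ × l ≡ l₀
      split refl = refl , refl

    χ-no-codeword : ∀ {w} → ¬ Codeword w → ∀ l u → χ perfect (l ∷ u ∷ w) ≡ 0
    χ-no-codeword {w} none l u =
      𝟙-false (decode perfect (l ∷ u ∷ w) ≟ᵥ (l ∷ u ∷ w)) λ eq → none (l , u , eq)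

    weight≤1 : ∀ w → weight w ≤ 1
    weight≤1 w with codeword? w
    ... | yes (l₀ , u₀ , eq) = ≤-reflexive (trans
      (sum-cong-≗ λ l → sum-cong-≗ λ u → χ-codeword eq l u)
      (∑∑-graph {p = p} (λ _ → u₀) (λ _ → l₀) w))
    ... | no none = ≤-trans
      (≤-reflexive (∑-zero q′ λ l → ∑-zero q′ λ u → χ-no-codeword none l u)) z≤n

    -- If no codeword ends in w, the q² points over w are covered from the lines through w,
    -- which carry at most one codeword for each of their p q < q² points.
    codeword : ∀ w → Codeword w
    codeword w with codeword? w
    ... | yes c = c
    ... | no none = contradiction q²≤pq (<⇒≱ (*-monoˡ-< q′ (n<1+n p)))
      where
      open ≤-Reasoning
      one : ∀ l u → lineSum (λ w′ → χ perfect (l ∷ u ∷ w′)) w ≡ 1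
      one l u = trans
        (sym (cong₂ (λ i j → i + (j + lineSum (λ w′ → χ perfect (l ∷ u ∷ w′)) w))
          (∑-zero q′ λ l′ → χ-no-codeword none l′ u)
          (∑-zero q′ λ u′ → χ-no-codeword none l u′)))
        (trans (lineSum-χ′ (l ∷ u ∷ w))
          (cong suc (trans (cong (q′ *_) (χ-no-codeword none l u)) (*-zeroʳ q′))))
      q²≤pq : q′ * q′ ≤ p * q′
      q²≤pq = begin
        q′ * q′
          ≡⟨ cong (q′ *_) (*-identityʳ q′) ⟨
        q′ * (q′ * 1)
          ≡⟨ trans (sum-cong-≗ {q′} λ _ → ∑-const q′ 1) (∑-const q′ (q′ * 1)) ⟨
        ∑[ l < q′ ] ∑[ u < q′ ] 1
          ≡⟨ sum-cong-≗ (λ l → sum-cong-≗ λ u → one l u) ⟨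
        ∑[ l < q′ ] ∑[ u < q′ ] lineSum (λ w′ → χ perfect (l ∷ u ∷ w′)) w
          ≡⟨ sum-cong-≗ (λ l → lineSum-∑ (λ u w′ → χ perfect (l ∷ u ∷ w′)) w) ⟨
        ∑[ l < q′ ] lineSum (λ w′ → ∑[ u < q′ ] χ perfect (l ∷ u ∷ w′)) w
          ≡⟨ lineSum-∑ (λ l w′ → ∑[ u < q′ ] χ perfect (l ∷ u ∷ w′)) w ⟨
        lineSum weight w
          ≤⟨ ∑-mono p (λ i → ∑-mono q′ λ a → weight≤1 (w [ i ]≔ a)) ⟩
        lineSum (λ _ → 1) w
          ≡⟨ lineSum-const 1 w ⟩
        p * (q′ * 1)
          ≡⟨ cong (p *_) (*-identityʳ q′) ⟩
        p * q′ ∎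

  -- Over each `w` there is a codeword by `codeword`, and only one by `codeword-unique`, so the code
  -- is a graph. The line identity is perfection in counting form: a codeword is met on all q + 1 of
  -- its lines, and from any other vertex exactly one codeword is met.
  perfectCode-graph : ∃₂ λ U Λ → ∀ v → lineSum (graph {1 + p} {p} U Λ) v ≡ 1 + (1 + p) * graph U Λ v
  perfectCode-graph = U , Λ , λ v → trans
    (trans (sym (lineSum-cong χ≡graph v)) (lineSum-χ′ v))
    (cong (λ k → 1 + q′ * k) (χ≡graph v))
    where
    U Λ : Vertex p q′ → Fin q′
    U w = proj₁ (proj₂ (codeword w))
    Λ w = proj₁ (codeword w)
    χ≡graph : ∀ v → χ perfect v ≡ graph U Λ v
    χ≡graph (l ∷ u ∷ w) = χ-codeword (proj₂ (proj₂ (codeword w))) l u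

-- A totally symmetric Latin square.

module TotallySymmetric (p : ℕ) where

  -- a + b + c ≡ p modulo p + 1.
  Balanced : Fin (suc p) → Fin (suc p) → Fin (suc p) → Set
  Balanced a b c = toℕ a + toℕ b + toℕ c ≡ p ⊎ toℕ a + toℕ b + toℕ c ≡ p + suc p

  balance : ∀ a b → ∃ λ c → Balanced a b c
  balance a b with toℕ a + toℕ b ≤? p
  ... | yes s≤p = fromℕ< c<q , inj₁ (trans (cong (λ c → toℕ a + toℕ b + c) (toℕ-fromℕ< c<q)) (m+[n∸m]≡n s≤p))
    where
    c<q : p ∸ (toℕ a + toℕ b) < suc p
    c<q = s≤s (m∸n≤m p (toℕ a + toℕ b))
  ... | no s≰p = fromℕ< c<q , inj₂ (trans (cong (λ c → toℕ a + toℕ b + c) (toℕ-fromℕ< c<q)) (m+[n∸m]≡n s≤))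
    where
    c<q : p + suc p ∸ (toℕ a + toℕ b) < suc p
    c<q = s≤s (m≤n+o⇒m∸n≤o (p + suc p) _
      (≤-trans (≤-reflexive (+-comm p (suc p))) (+-monoˡ-≤ p (≰⇒> s≰p))))
    s≤ : toℕ a + toℕ b ≤ p + suc p
    s≤ = +-mono-≤ (≤-pred (toℕ<n a)) (<⇒≤ (toℕ<n b))

  infixr 7 _∗_
  -- `Balanced` is symmetric in its three arguments, which makes `∗` commutative and each left
  -- translation an involution: a ∗ x = b is solved by x = a ∗ b, without a separate division.
  _∗_ : Fin (suc p) → Fin (suc p) → Fin (suc p)
  a ∗ b = proj₁ (balance a b)

  private
    -- The two admissible totals differ by p + 1, more than any change of the third entry.
    ¬wrap : ∀ s (c d : Fin (suc p)) → s + toℕ c ≡ p → s + toℕ d ≢ p + suc p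
    ¬wrap s c d eq eq′ = contradiction (toℕ<n d) (≤⇒≯ (begin
      suc p           ≤⟨ m≤n+m (suc p) (toℕ c) ⟩
      toℕ c + suc p   ≡⟨ +-cancelˡ-≡ s _ _ (trans (sym (+-assoc s (toℕ c) (suc p)))
                           (trans (cong (_+ suc p) eq) (sym eq′))) ⟩
      toℕ d           ∎))
      where open ≤-Reasoning

  balanced-unique : ∀ {a b c d} → Balanced a b c → Balanced a b d → c ≡ d
  balanced-unique (inj₁ eq) (inj₁ eq′) = toℕ-injective (+-cancelˡ-≡ _ _ _ (trans eq (sym eq′)))
  balanced-unique (inj₂ eq) (inj₂ eq′) = toℕ-injective (+-cancelˡ-≡ _ _ _ (trans eq (sym eq′)))
  balanced-unique {c = c} {d} (inj₁ eq) (inj₂ eq′) = contradiction eq′ (¬wrap _ c d eq)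
  balanced-unique {c = c} {d} (inj₂ eq) (inj₁ eq′) = contradiction eq (¬wrap _ d c eq′)

  balanced-resp : ∀ a b c a′ b′ c′ → toℕ a′ + toℕ b′ + toℕ c′ ≡ toℕ a + toℕ b + toℕ c →
    Balanced a b c → Balanced a′ b′ c′
  balanced-resp a b c a′ b′ c′ eq (inj₁ e) = inj₁ (trans eq e)
  balanced-resp a b c a′ b′ c′ eq (inj₂ e) = inj₂ (trans eq e)

  ∗-comm : ∀ a b → a ∗ b ≡ b ∗ a
  ∗-comm a b = balanced-unique {a} {b} (proj₂ (balance a b))
    (balanced-resp b a (b ∗ a) a b (b ∗ a) (cong (_+ toℕ (b ∗ a)) (+-comm (toℕ a) (toℕ b))) (proj₂ (balance b a)))

  ∗-involutive : ∀ a b → a ∗ a ∗ b ≡ b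
  ∗-involutive a b = balanced-unique {a} {a ∗ b} (proj₂ (balance a (a ∗ b)))
    (balanced-resp a b (a ∗ b) a (a ∗ b) b (swap (toℕ a) (toℕ (a ∗ b)) (toℕ b)) (proj₂ (balance a b)))
    where
    swap : ∀ i j k → i + j + k ≡ i + k + j
    swap = solve-∀

  ∑-∗ˡ : ∀ a (g : Fin (suc p) → ℕ) → ∑[ b < suc p ] g (a ∗ b) ≡ sum g
  ∑-∗ˡ a g = sym (∑-permute g (permutation (a ∗_) (a ∗_) (∗-involutive a) (∗-involutive a)))

  ∑-∗ʳ : ∀ a (g : Fin (suc p) → ℕ) → ∑[ b < suc p ] g (b ∗ a) ≡ sum g
  ∑-∗ʳ a g = trans (sum-cong-≗ λ b → cong g (∗-comm b a)) (∑-∗ˡ a g)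

-- Line sums of functions on a block.

∑∑-select : (g : Fin q → Fin q → ℕ) → ∀ s₀ l₀ →
  ∑[ s < q ] ∑[ l < q ] (𝟙 (s ≟ s₀) * 𝟙 (l ≟ l₀) * g s l) ≡ g s₀ l₀
∑∑-select {q} g s₀ l₀ = begin
  ∑[ s < q ] ∑[ l < q ] (𝟙 (s ≟ s₀) * 𝟙 (l ≟ l₀) * g s l)
    ≡⟨ sum-cong-≗ (λ s → trans
         (sum-cong-≗ λ l → *-assoc (𝟙 (s ≟ s₀)) (𝟙 (l ≟ l₀)) (g s l))
         (trans (sym (*-distribˡ-sum (𝟙 (s ≟ s₀)) (λ l → 𝟙 (l ≟ l₀) * g s l)))
                (cong (𝟙 (s ≟ s₀) *_) (∑-select l₀ (g s))))) ⟩
  ∑[ s < q ] (𝟙 (s ≟ s₀) * g s l₀)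
    ≡⟨ ∑-select s₀ (λ s → g s l₀) ⟩
  g s₀ l₀ ∎
  where open ≡-Reasoning

-- For `s ≢ π x`, `fibre-count` says that each class is met once from `x`. For `s ≡ π x` it leaves q
-- times the indicator of the label of `x`; with n = q this is `x` itself on its q lines, so no
-- neighbour stays in the fibre.
module _ (π ℓ : Vertex n q → Fin q)
  (fibre-count : ∀ s l x →
    lineSum (λ v → 𝟙 (s ≟ π v) * 𝟙 (l ≟ ℓ v)) x + 𝟙 (s ≟ π x)
      ≡ 1 + q * (𝟙 (s ≟ π x) * 𝟙 (l ≟ ℓ x))) where

  -- A function of π and ℓ is a linear combination of class indicators with coefficients `g s l`, so
  -- `fibre-count` is weighted by these and summed over all classes. Terms that would be subtracted
  -- stand on the left, to remain in ℕ.
  block-lineSum : ∀ (g : Fin q → Fin q → ℕ) x →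
    lineSum (λ v → g (π v) (ℓ v)) x + sum (g (π x))
      ≡ q * g (π x) (ℓ x) + ∑[ s < q ] sum (g s)
  block-lineSum g x = begin
    lineSum (λ v → g (π v) (ℓ v)) x + sum (g (π x))
      ≡⟨ cong₂ _+_ expand (sym (∑-select (π x) (λ s → sum (g s)))) ⟩
    (∑[ s < q ] ∑[ l < q ] (A s l * g s l)) + ∑[ s < q ] (𝟙 (s ≟ π x) * sum (g s))
      ≡⟨ ∑-distrib-+ (λ s → ∑[ l < q ] (A s l * g s l)) (λ s → 𝟙 (s ≟ π x) * sum (g s)) ⟨
    ∑[ s < q ] (∑[ l < q ] (A s l * g s l) + 𝟙 (s ≟ π x) * sum (g s))
      ≡⟨ sum-cong-≗ (λ s → row s) ⟩
    ∑[ s < q ] (q * ∑[ l < q ] (𝟙 (s ≟ π x) * 𝟙 (l ≟ ℓ x) * g s l) + sum (g s))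
      ≡⟨ ∑-distrib-+ (λ s → q * ∑[ l < q ] (𝟙 (s ≟ π x) * 𝟙 (l ≟ ℓ x) * g s l)) (λ s → sum (g s)) ⟩
    (∑[ s < q ] (q * ∑[ l < q ] (𝟙 (s ≟ π x) * 𝟙 (l ≟ ℓ x) * g s l))) + ∑[ s < q ] sum (g s)
      ≡⟨ cong (_+ ∑[ s < q ] sum (g s)) (trans
           (sym (*-distribˡ-sum q (λ s → ∑[ l < q ] (𝟙 (s ≟ π x) * 𝟙 (l ≟ ℓ x) * g s l))))
           (cong (q *_) (∑∑-select g (π x) (ℓ x)))) ⟩
    q * g (π x) (ℓ x) + ∑[ s < q ] sum (g s) ∎
    where
    open ≡-Reasoning
    A : Fin q → Fin q → ℕ
    A s l = lineSum (λ v → 𝟙 (s ≟ π v) * 𝟙 (l ≟ ℓ v)) x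
    expand : lineSum (λ v → g (π v) (ℓ v)) x ≡ ∑[ s < q ] ∑[ l < q ] (A s l * g s l)
    expand = begin
      lineSum (λ v → g (π v) (ℓ v)) x
        ≡⟨ lineSum-cong (λ v → ∑∑-select g (π v) (ℓ v)) x ⟨
      lineSum (λ v → ∑[ s < q ] ∑[ l < q ] (𝟙 (s ≟ π v) * 𝟙 (l ≟ ℓ v) * g s l)) x
        ≡⟨ lineSum-∑ (λ s v → ∑[ l < q ] (𝟙 (s ≟ π v) * 𝟙 (l ≟ ℓ v) * g s l)) x ⟩
      ∑[ s < q ] lineSum (λ v → ∑[ l < q ] (𝟙 (s ≟ π v) * 𝟙 (l ≟ ℓ v) * g s l)) x
        ≡⟨ sum-cong-≗ (λ s → trans
             (lineSum-∑ (λ l v → 𝟙 (s ≟ π v) * 𝟙 (l ≟ ℓ v) * g s l) x)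
             (sum-cong-≗ λ l → lineSum-*ʳ (λ v → 𝟙 (s ≟ π v) * 𝟙 (l ≟ ℓ v)) (g s l) x)) ⟩
      ∑[ s < q ] ∑[ l < q ] (A s l * g s l) ∎
    entry : ∀ s l → A s l * g s l + 𝟙 (s ≟ π x) * g s l
      ≡ q * (𝟙 (s ≟ π x) * 𝟙 (l ≟ ℓ x) * g s l) + g s l
    entry s l = begin
      A s l * g s l + 𝟙 (s ≟ π x) * g s l
        ≡⟨ *-distribʳ-+ (g s l) (A s l) _ ⟨
      (A s l + 𝟙 (s ≟ π x)) * g s l
        ≡⟨ cong (_* g s l) (fibre-count s l x) ⟩
      (1 + q * (𝟙 (s ≟ π x) * 𝟙 (l ≟ ℓ x))) * g s l
        ≡⟨ rearrange q (𝟙 (s ≟ π x) * 𝟙 (l ≟ ℓ x)) (g s l) ⟩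
      q * (𝟙 (s ≟ π x) * 𝟙 (l ≟ ℓ x) * g s l) + g s l ∎
      where
      rearrange : ∀ i j k → (1 + i * j) * k ≡ i * (j * k) + k
      rearrange = solve-∀
    row : ∀ s → ∑[ l < q ] (A s l * g s l) + 𝟙 (s ≟ π x) * sum (g s)
      ≡ q * ∑[ l < q ] (𝟙 (s ≟ π x) * 𝟙 (l ≟ ℓ x) * g s l) + sum (g s)
    row s = begin
      ∑[ l < q ] (A s l * g s l) + 𝟙 (s ≟ π x) * sum (g s)
        ≡⟨ cong (∑[ l < q ] (A s l * g s l) +_) (*-distribˡ-sum (𝟙 (s ≟ π x)) (g s)) ⟩
      ∑[ l < q ] (A s l * g s l) + ∑[ l < q ] (𝟙 (s ≟ π x) * g s l)
        ≡⟨ ∑-distrib-+ (λ l → A s l * g s l) (λ l → 𝟙 (s ≟ π x) * g s l) ⟨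
      ∑[ l < q ] (A s l * g s l + 𝟙 (s ≟ π x) * g s l)
        ≡⟨ sum-cong-≗ (entry s) ⟩
      ∑[ l < q ] (q * (𝟙 (s ≟ π x) * 𝟙 (l ≟ ℓ x) * g s l) + g s l)
        ≡⟨ ∑-distrib-+ (λ l → q * (𝟙 (s ≟ π x) * 𝟙 (l ≟ ℓ x) * g s l)) (g s) ⟩
      ∑[ l < q ] (q * (𝟙 (s ≟ π x) * 𝟙 (l ≟ ℓ x) * g s l)) + sum (g s)
        ≡⟨ cong (_+ sum (g s)) (*-distribˡ-sum q (λ l → 𝟙 (s ≟ π x) * 𝟙 (l ≟ ℓ x) * g s l)) ⟨
      q * ∑[ l < q ] (𝟙 (s ≟ π x) * 𝟙 (l ≟ ℓ x) * g s l) + sum (g s) ∎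

-- Block and label maps from a perfect code.

module Decoding {p : ℕ} (U Λ : Vertex p (1 + p) → Fin (1 + p))
  (lineSum-graph : ∀ v → lineSum (graph U Λ) v ≡ 1 + (1 + p) * graph U Λ v) where

  open TotallySymmetric p

  private
    q′ = 1 + p

  π ℓ : Vertex q′ q′ → Fin q′
  π (u ∷ w) = u ∗ U w
  ℓ (u ∷ w) = Λ w

  -- Since `u ∗ s ≡ U w` exactly when `s ≡ u ∗ U w`, this carries the fibre π = s onto the graph of
  -- `U`. Right translation is a bijection, so line sums are carried along and one code counts all q
  -- fibres.
  twist : Fin q′ → Vertex q′ q′ → Vertex q′ q′
  twist s (u ∷ w) = u ∗ s ∷ w

  graph-twist : ∀ s l x → graph U Λ (l ∷ twist s x) ≡ 𝟙 (s ≟ π x) * 𝟙 (l ≟ ℓ x)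
  graph-twist s l (u ∷ w) = cong (_* 𝟙 (l ≟ Λ w)) (𝟙-cong (u ∗ s ≟ U w) (s ≟ u ∗ U w)
    (λ eq → trans (sym (∗-involutive u s)) (cong (u ∗_) eq))
    (λ eq → trans (cong (u ∗_) eq) (∗-involutive u (U w))))

  lineSum-twist : ∀ s (h : Vertex q′ q′ → ℕ) x → lineSum (h ∘ twist s) x ≡ lineSum h (twist s x)
  lineSum-twist s h (u ∷ w) = cong (_+ lineSum (λ w′ → h (u ∗ s ∷ w′)) w)
    (∑-∗ʳ s (λ a → h (a ∷ w)))

  -- The code identity is applied at `l ∷ twist s x`. Its lines in the block directions give the
  -- wanted line sum; the line in the label direction meets the code only if the twisted vertex lies
  -- on the graph of `U`, that is, if `s ≡ π x`.
  fibre-count : ∀ s l x →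
    lineSum (λ v → 𝟙 (s ≟ π v) * 𝟙 (l ≟ ℓ v)) x + 𝟙 (s ≟ π x)
      ≡ 1 + q′ * (𝟙 (s ≟ π x) * 𝟙 (l ≟ ℓ x))
  fibre-count s l x = begin
    lineSum (λ v → 𝟙 (s ≟ π v) * 𝟙 (l ≟ ℓ v)) x + 𝟙 (s ≟ π x)
      ≡⟨ cong₂ _+_
           (trans (lineSum-cong (λ v → sym (graph-twist s l v)) x)
                  (lineSum-twist s (λ v → graph U Λ (l ∷ v)) x))
           (sym column) ⟩
    lineSum (λ v → graph U Λ (l ∷ v)) (twist s x) + ∑[ l′ < q′ ] graph U Λ (l′ ∷ twist s x)
      ≡⟨ +-comm (lineSum (λ v → graph U Λ (l ∷ v)) (twist s x)) _ ⟩
    lineSum (graph U Λ) (l ∷ twist s x)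
      ≡⟨ lineSum-graph (l ∷ twist s x) ⟩
    1 + q′ * graph U Λ (l ∷ twist s x)
      ≡⟨ cong (λ k → 1 + q′ * k) (graph-twist s l x) ⟩
    1 + q′ * (𝟙 (s ≟ π x) * 𝟙 (l ≟ ℓ x)) ∎
    where
    open ≡-Reasoning
    column : ∑[ l′ < q′ ] graph U Λ (l′ ∷ twist s x) ≡ 𝟙 (s ≟ π x)
    column = begin
      ∑[ l′ < q′ ] graph U Λ (l′ ∷ twist s x)
        ≡⟨ sum-cong-≗ (λ l′ → trans (graph-twist s l′ x) (*-comm (𝟙 (s ≟ π x)) _)) ⟩
      ∑[ l′ < q′ ] (𝟙 (l′ ≟ ℓ x) * 𝟙 (s ≟ π x))
        ≡⟨ ∑-select (ℓ x) (λ _ → 𝟙 (s ≟ π x)) ⟩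
      𝟙 (s ≟ π x) ∎

  -- Seen from a vertex outside the fibre of `s`, every label occurs once in that fibre, so no class
  -- of it is empty.
  πℓ-surjective : ∀ {s₁} s l → s₁ ≢ s → ∃ λ x → π x ≡ s × ℓ x ≡ l
  πℓ-surjective {s₁} s l s₁≢s =
    member (lineSum-positive g x₁ (λ eq → 0≢1+n (trans (sym eq) count)))
    where
    w₁ : Vertex p q′
    w₁ = replicate p s
    x₁ : Vertex q′ q′
    -- The tail is arbitrary; the head is the solution u of `u ∗ U w₁ ≡ s₁`.
    x₁ = U w₁ ∗ s₁ ∷ w₁
    g : Vertex q′ q′ → ℕ
    g v = 𝟙 (s ≟ π v) * 𝟙 (l ≟ ℓ v)
    πx₁≡s₁ : π x₁ ≡ s₁
    πx₁≡s₁ = trans (∗-comm (U w₁ ∗ s₁) (U w₁)) (∗-involutive (U w₁) s₁)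
    miss : 𝟙 (s ≟ π x₁) ≡ 0
    miss = 𝟙-false (s ≟ π x₁) λ eq → s₁≢s (trans (sym πx₁≡s₁) (sym eq))
    count : lineSum g x₁ ≡ suc (q′ * g x₁)
    count = trans
      (trans (sym (+-identityʳ (lineSum g x₁))) (cong (lineSum g x₁ +_) (sym miss)))
      (fibre-count s l x₁)
    both : ∀ v (d : Dec (s ≡ π v)) (e : Dec (l ≡ ℓ v)) → 𝟙 d * 𝟙 e ≢ 0 → π v ≡ s × ℓ v ≡ l
    both v (yes s≡) (yes l≡) _ = sym s≡ , sym l≡
    both v (yes _) (no _) ≢0 = contradiction refl ≢0
    both v (no _) _ ≢0 = contradiction refl ≢0
    member : (∃ λ v → g v ≢ 0) → ∃ λ x → π x ≡ s × ℓ x ≡ l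
    member (v , gv≢0) = v , both v (s ≟ π v) (l ≟ ℓ v) gv≢0

-- Cutting a vertex into blocks and single coordinates.

take-++ : (x : Vertex m q) (r : Vertex n q) → take m (x ++ r) ≡ x
take-++ [] r = refl
take-++ (u ∷ x) r = cong (u ∷_) (take-++ x r)

drop-++ : (x : Vertex m q) (r : Vertex n q) → drop m (x ++ r) ≡ r
drop-++ [] r = refl
drop-++ (u ∷ x) r = drop-++ x r

module Blocks (π ℓ : Vertex q q → Fin q)
  (block : ∀ (g : Fin q → Fin q → ℕ) x →
    lineSum (λ v → g (π v) (ℓ v)) x + sum (g (π x))
      ≡ q * g (π x) (ℓ x) + ∑[ s < q ] sum (g s))
  (_∗_ : Fin q → Fin q → Fin q)
  (∑-∗ˡ : ∀ a (g : Fin q → ℕ) → ∑[ b < q ] g (a ∗ b) ≡ sum g)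
  (∑-∗ʳ : ∀ a (g : Fin q → ℕ) → ∑[ b < q ] g (b ∗ a) ≡ sum g)
  (∗-involutive : ∀ a b → a ∗ (a ∗ b) ≡ b)
  (∗-comm : ∀ a b → a ∗ b ≡ b ∗ a)
  (ε : Fin q) (m : ℕ) where

  fold : Vertex n q → Fin q
  fold [] = ε
  fold (a ∷ z) = a ∗ fold z

  -- In a Latin square one free entry makes the product run through every label once, whatever the
  -- other entries are.
  lineSum-fold : ∀ (g : Fin q → ℕ) (z : Vertex n q) → lineSum (g ∘ fold) z ≡ n * sum g
  lineSum-fold g [] = refl
  lineSum-fold {suc n} g (a ∷ z) = cong₂ _+_ (∑-∗ʳ (fold z) g)
    (trans (lineSum-fold (λ l → g (a ∗ l)) z) (cong (n *_) (∑-∗ˡ a g)))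

  -- The number `n * q + m`, in a recursive form in which splitting off a block needs no rewriting.
  size : ℕ → ℕ
  size zero = m
  size (suc n) = q + size n

  project : ∀ n → Vertex (size n) q → Vertex n q
  project zero _ = []
  project (suc n) X = π (take q X) ∷ project n (drop q X)

  tag : ∀ n → Vertex (size n) q → Fin q
  tag zero z = fold z
  tag (suc n) X = ℓ (take q X) ∗ tag n (drop q X)

  project-++ : ∀ n x r → project (suc n) (x ++ r) ≡ π x ∷ project n r
  project-++ n x r = cong₂ (λ x r → π x ∷ project n r) (take-++ x r) (drop-++ x r)

  tag-++ : ∀ n x r → tag (suc n) (x ++ r) ≡ ℓ x ∗ tag n r
  tag-++ n x r = cong₂ (λ x r → ℓ x ∗ tag n r) (take-++ x r) (drop-++ x r)

  -- Moving within one block reaches every label once for each changed value of π, and no other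
  -- vertex with the same value. This gives the line sum of `sum ∘ g`, less one term per block for
  -- the unchanged value (moved to the left), plus `X` itself on its n q block lines. Each of the m
  -- single coordinates runs through all labels over the unchanged projection.
  lineSum-project : ∀ n (g : Vertex n q → Fin q → ℕ) X →
    lineSum (λ V → g (project n V) (tag n V)) X + n * sum (g (project n X))
      ≡ n * (q * g (project n X) (tag n X)) + lineSum (sum ∘ g) (project n X) + m * sum (g (project n X))
  lineSum-project zero g z = trans (+-identityʳ _) (lineSum-fold (g []) z)
  lineSum-project (suc n) g X = subst Goal (take++drop≡id q X) (step (take q X) (drop q X))
    where
    open ≡-Reasoning
    Goal : Vertex (q + size n) q → Set
    Goal X = lineSum (λ V → g (project (suc n) V) (tag (suc n) V)) X + suc n * sum (g (project (suc n) X))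
      ≡ suc n * (q * g (project (suc n) X) (tag (suc n) X))
        + lineSum (sum ∘ g) (project (suc n) X) + m * sum (g (project (suc n) X))
    combine : ∀ {A B G K D E M} k → A + G ≡ K + D → B + k * G ≡ k * K + E + M →
      A + B + suc k * G ≡ suc k * K + (D + E) + M
    combine {A} {B} {G} {K} {D} {E} {M} k eq₁ eq₂ = begin
      A + B + suc k * G              ≡⟨ left A B G k ⟩
      (A + G) + (B + k * G)          ≡⟨ cong₂ _+_ eq₁ eq₂ ⟩
      (K + D) + (k * K + E + M)      ≡⟨ right K D k E M ⟩
      suc k * K + (D + E) + M        ∎
      where
      left : ∀ A B G k → A + B + (1 + k) * G ≡ (A + G) + (B + k * G)
      left = solve-∀
      right : ∀ K D k E M → (K + D) + (k * K + E + M) ≡ (1 + k) * K + (D + E) + M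
      right = solve-∀
    step : ∀ x r → Goal (x ++ r)
    step x r = begin
      lineSum (λ V → g (project (suc n) V) (tag (suc n) V)) (x ++ r) + suc n * sum (g (project (suc n) (x ++ r)))
        ≡⟨ cong₂ _+_
             (trans (lineSum-++ (λ V → g (project (suc n) V) (tag (suc n) V)) x r) (cong₂ _+_
               (lineSum-cong (λ x′ → cong₂ g (project-++ n x′ r) (tag-++ n x′ r)) x)
               (lineSum-cong (λ r′ → cong₂ g (project-++ n x r′) (tag-++ n x r′)) r)))
             (cong (λ y → suc n * sum (g y)) (project-++ n x r)) ⟩
      lineSum (λ x′ → g (π x′ ∷ y) (ℓ x′ ∗ L)) x
        + lineSum (λ r′ → g (π x ∷ project n r′) (ℓ x ∗ tag n r′)) r
        + suc n * sum (g (π x ∷ y))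
        ≡⟨ combine n first rest ⟩
      suc n * (q * g (π x ∷ y) (ℓ x ∗ L)) + lineSum (sum ∘ g) (π x ∷ y) + m * sum (g (π x ∷ y))
        ≡⟨ cong₂ (λ y L → suc n * (q * g y L) + lineSum (sum ∘ g) y + m * sum (g y))
             (project-++ n x r) (tag-++ n x r) ⟨
      suc n * (q * g (project (suc n) (x ++ r)) (tag (suc n) (x ++ r)))
        + lineSum (sum ∘ g) (project (suc n) (x ++ r)) + m * sum (g (project (suc n) (x ++ r))) ∎
      where
      y = project n r
      L = tag n r
      -- The other coordinates are frozen and only translate labels by `L`, which leaves a sum over
      -- all labels unchanged.
      first : lineSum (λ x′ → g (π x′ ∷ y) (ℓ x′ ∗ L)) x + sum (g (π x ∷ y))
        ≡ q * g (π x ∷ y) (ℓ x ∗ L) + ∑[ s < q ] sum (g (s ∷ y))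
      first = begin
        lineSum (λ x′ → g (π x′ ∷ y) (ℓ x′ ∗ L)) x + sum (g (π x ∷ y))
          ≡⟨ cong (lineSum (λ x′ → g (π x′ ∷ y) (ℓ x′ ∗ L)) x +_) (∑-∗ʳ L (g (π x ∷ y))) ⟨
        lineSum (λ x′ → g (π x′ ∷ y) (ℓ x′ ∗ L)) x + ∑[ l < q ] g (π x ∷ y) (l ∗ L)
          ≡⟨ block (λ s l → g (s ∷ y) (l ∗ L)) x ⟩
        q * g (π x ∷ y) (ℓ x ∗ L) + ∑[ s < q ] ∑[ l < q ] g (s ∷ y) (l ∗ L)
          ≡⟨ cong (q * g (π x ∷ y) (ℓ x ∗ L) +_) (sum-cong-≗ λ s → ∑-∗ʳ L (g (s ∷ y))) ⟩
        q * g (π x ∷ y) (ℓ x ∗ L) + ∑[ s < q ] sum (g (s ∷ y)) ∎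
      shift : ∀ v → ∑[ l < q ] g (π x ∷ v) (ℓ x ∗ l) ≡ sum (g (π x ∷ v))
      shift v = ∑-∗ˡ (ℓ x) (g (π x ∷ v))
      rest : lineSum (λ r′ → g (π x ∷ project n r′) (ℓ x ∗ tag n r′)) r + n * sum (g (π x ∷ y))
        ≡ n * (q * g (π x ∷ y) (ℓ x ∗ L)) + lineSum (λ v → sum (g (π x ∷ v))) y + m * sum (g (π x ∷ y))
      rest = begin
        lineSum (λ r′ → g (π x ∷ project n r′) (ℓ x ∗ tag n r′)) r + n * sum (g (π x ∷ y))
          ≡⟨ cong (λ k → lineSum (λ r′ → g (π x ∷ project n r′) (ℓ x ∗ tag n r′)) r + n * k) (shift y) ⟨
        lineSum (λ r′ → g (π x ∷ project n r′) (ℓ x ∗ tag n r′)) r + n * ∑[ l < q ] g (π x ∷ y) (ℓ x ∗ l)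
          ≡⟨ lineSum-project n (λ v l → g (π x ∷ v) (ℓ x ∗ l)) r ⟩
        n * (q * g (π x ∷ y) (ℓ x ∗ L)) + lineSum (λ v → ∑[ l < q ] g (π x ∷ v) (ℓ x ∗ l)) y
          + m * ∑[ l < q ] g (π x ∷ y) (ℓ x ∗ l)
          ≡⟨ cong₂ (λ i j → n * (q * g (π x ∷ y) (ℓ x ∗ L)) + i + m * j) (lineSum-cong shift y) (shift y) ⟩
        n * (q * g (π x ∷ y) (ℓ x ∗ L)) + lineSum (λ v → sum (g (π x ∷ v))) y + m * sum (g (π x ∷ y)) ∎

  module _ (πℓ-surjective : ∀ s l → ∃ λ x → π x ≡ s × ℓ x ≡ l) where

    project-surjective : ∀ n y → ∃ λ X → project n X ≡ y
    project-surjective zero [] = replicate m ε , refl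
    project-surjective (suc n) (s ∷ y)
      with x , πx≡s , _ ← πℓ-surjective s ε | r , eq ← project-surjective n y =
      x ++ r , trans (project-++ n x r) (cong₂ _∷_ πx≡s eq)

    -- Once the other blocks are chosen, the label of the first block is still free to correct the
    -- total: `tag n r ∗ l` solves `_ ∗ tag n r ≡ l`. Hence at least one block is required.
    project-tag-surjective : ∀ n y l → ∃ λ X → project (suc n) X ≡ y × tag (suc n) X ≡ l
    project-tag-surjective n (s ∷ y) l
      with r , eq ← project-surjective n y
      with x , πx≡s , ℓx≡ ← πℓ-surjective s (tag n r ∗ l) =
      x ++ r , trans (project-++ n x r) (cong₂ _∷_ πx≡s eq) ,
      trans (tag-++ n x r) (trans (cong (_∗ tag n r) ℓx≡)
        (trans (∗-comm (tag n r ∗ l) (tag n r)) (∗-involutive (tag n r) l)))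

-- Thresholds on labels and line sums of a two-colouring.

threshold : ℕ → Fin q → Fin 2
threshold t l = if does (toℕ l <? t) then colour1 else colour2

threshold-< : ∀ t (l : Fin q) → toℕ l < t → threshold t l ≡ colour1
threshold-< t l l<t = cong (if_then colour1 else colour2) (dec-true (toℕ l <? t) l<t)

threshold-≮ : ∀ t (l : Fin q) → ¬ toℕ l < t → threshold t l ≡ colour2
threshold-≮ t l l≮t = cong (if_then colour1 else colour2) (dec-false (toℕ l <? t) l≮t)

∑-threshold₁ : ∀ q t → t ≤ q → ∑[ l < q ] 𝟙 (threshold t l ≟ colour1) ≡ t
∑-threshold₁ q zero _ = ∑-zero q λ _ → refl
∑-threshold₁ (suc q) (suc t) (s≤s t≤q) = cong suc (∑-threshold₁ q t t≤q)

∑-threshold₂ : ∀ q t → t ≤ q → ∑[ l < q ] 𝟙 (threshold t l ≟ colour2) ≡ q ∸ t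
∑-threshold₂ q zero _ = trans (∑-const q 1) (*-identityʳ q)
∑-threshold₂ (suc q) (suc t) (s≤s t≤q) = ∑-threshold₂ q t t≤q

-- Of the n q positions on the lines through `x`, those of colour `k` are proper neighbours; all
-- others, `x` included, have colour `j`. The `T j` term on the left avoids a subtraction.
lineSum-colour : (f : Vertex n q → Fin 2) (T : Fin 2 → ℕ) (j k : Fin 2) → j ≢ k →
  ∀ x → f x ≡ j →
  lineSum (T ∘ f) x + nbrsOfColour f k x * T j ≡ n * q * T j + nbrsOfColour f k x * T k
lineSum-colour {n} {q} f T j k j≢k x fx≡j = begin
  lineSum (T ∘ f) x + nbrsOfColour f k x * T j
    ≡⟨ cong (λ d → lineSum (T ∘ f) x + d * T j) nbrs ⟩
  lineSum (T ∘ f) x + lineSum k? x * T j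
    ≡⟨ cong (lineSum (T ∘ f) x +_) (lineSum-*ʳ k? (T j) x) ⟨
  lineSum (T ∘ f) x + lineSum (λ v → k? v * T j) x
    ≡⟨ lineSum-+ (T ∘ f) (λ v → k? v * T j) x ⟨
  lineSum (λ v → T (f v) + k? v * T j) x
    ≡⟨ lineSum-cong (λ v → exchange (f v) (f v ≟ k)) x ⟩
  lineSum (λ v → T j + k? v * T k) x
    ≡⟨ lineSum-+ (λ _ → T j) (λ v → k? v * T k) x ⟩
  lineSum (λ _ → T j) x + lineSum (λ v → k? v * T k) x
    ≡⟨ cong₂ _+_ (trans (lineSum-const (T j) x) (sym (*-assoc n q (T j)))) (lineSum-*ʳ k? (T k) x) ⟩
  n * q * T j + lineSum k? x * T k
    ≡⟨ cong (λ d → n * q * T j + d * T k) nbrs ⟨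
  n * q * T j + nbrsOfColour f k x * T k ∎
  where
  open ≡-Reasoning
  k? : Vertex n q → ℕ
  k? v = 𝟙 (f v ≟ k)
  nbrs : nbrsOfColour f k x ≡ lineSum k? x
  nbrs = nbrsOfColour≡lineSum f k x λ fx≡k → j≢k (trans (sym fx≡j) fx≡k)
  third : ∀ (i j k : Fin 2) → j ≢ k → i ≢ k → i ≡ j
  third zero zero _ _ _ = refl
  third (suc zero) (suc zero) _ _ _ = refl
  third zero (suc zero) zero _ i≢k = contradiction refl i≢k
  third zero (suc zero) (suc zero) j≢k _ = contradiction refl j≢k
  third (suc zero) zero zero j≢k _ = contradiction refl j≢k
  third (suc zero) zero (suc zero) _ i≢k = contradiction refl i≢k
  exchange : ∀ i (d : Dec (i ≡ k)) → T i + 𝟙 d * T j ≡ T j + 𝟙 d * T k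
  exchange i (yes refl) = trans (cong (T k +_) (+-identityʳ (T j)))
    (trans (+-comm (T k) (T j)) (cong (T j +_) (sym (+-identityʳ (T k)))))
  exchange i (no i≢k) = cong (λ i → T i + 0) (third i j k j≢k i≢k)

-- Merging classes into the new colouring.

module Recolouring {N n q m b c : ℕ} (f : Vertex n q → Fin 2) (f-colouring : IsColouring n q b c f)
  (project : Vertex N q → Vertex n q) (tag : Vertex N q → Fin q)
  (lineSum-project : ∀ (g : Vertex n q → Fin q → ℕ) X →
    lineSum (λ V → g (project V) (tag V)) X + n * sum (g (project X))
      ≡ n * (q * g (project X) (tag X)) + lineSum (sum ∘ g) (project X) + m * sum (g (project X)))
  (surjective : ∀ y l → ∃ λ X → project X ≡ y × tag X ≡ l)
  (length-eq : n * q + m ≡ n + (b + c))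
  (t : Fin 2 → ℕ) (t≤q : ∀ j → t j ≤ q) where

  open IsColouring f-colouring

  F : Vertex N q → Fin 2
  F X = threshold (t (f (project X))) (tag X)

  quota : Fin 2 → Fin 2 → ℕ
  quota k j = ∑[ l < q ] 𝟙 (threshold (t j) l ≟ k)

  -- No class merged into `k` contains `X`, so its own term drops out. Let j be the colour of
  -- `project X`, and d (b or c) its number of neighbours of the other colour. Such a class receives
  -- d neighbours of `X` if it has the other colour, and n q + m - n - d if it has colour j; by
  -- `length-eq` the latter is b + c - d. Either way this is c for colour 1 and b for colour 2.
  nbrs-F : ∀ k X → F X ≢ k → nbrsOfColour F k X ≡ c * quota k zero + b * quota k (suc zero)
  nbrs-F k X FX≢k = trans (nbrsOfColour≡lineSum F k X FX≢k) (by-colour (f y) refl)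
    where
    open ≡-Reasoning
    y = project X
    T = quota k
    S = lineSum (λ V → 𝟙 (F V ≟ k)) X
    total : S + n * T (f y) ≡ lineSum (T ∘ f) y + m * T (f y)
    total = trans (lineSum-project (λ v l → 𝟙 (threshold (t (f v)) l ≟ k)) X)
      (cong (λ i → i + lineSum (T ∘ f) y + m * T (f y))
        (trans (cong (λ i → n * (q * i)) (𝟙-false (F X ≟ k) FX≢k))
               (trans (cong (n *_) (*-zeroʳ q)) (*-zeroʳ n))))
    count : ∀ j i d d′ → j ≢ i → f y ≡ j → nbrsOfColour f i y ≡ d → d + d′ ≡ b + c →
      S ≡ d′ * T j + d * T i
    count j i d d′ j≢i fy≡j nbrs sum-d = +-cancelˡ-≡ ((n + d) * T j) _ _ (begin
      (n + d) * T j + S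
        ≡⟨ e₁ n d (T j) S ⟩
      S + n * T j + d * T j
        ≡⟨ cong (_+ d * T j) (subst (λ j → S + n * T j ≡ lineSum (T ∘ f) y + m * T j) fy≡j total) ⟩
      lineSum (T ∘ f) y + m * T j + d * T j
        ≡⟨ e₂ (lineSum (T ∘ f) y) (m * T j) (d * T j) ⟩
      lineSum (T ∘ f) y + d * T j + m * T j
        ≡⟨ cong (_+ m * T j) (subst (λ d → lineSum (T ∘ f) y + d * T j ≡ n * q * T j + d * T i) nbrs
             (lineSum-colour f T j i j≢i y fy≡j)) ⟩
      n * q * T j + d * T i + m * T j
        ≡⟨ e₃ (n * q) (T j) (d * T i) m ⟩
      (n * q + m) * T j + d * T i
        ≡⟨ cong (λ k → k * T j + d * T i) (trans length-eq (cong (n +_) (sym sum-d))) ⟩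
      (n + (d + d′)) * T j + d * T i
        ≡⟨ e₄ n d d′ (T j) (d * T i) ⟩
      (n + d) * T j + (d′ * T j + d * T i) ∎)
      where
      e₁ : ∀ n d u S → (n + d) * u + S ≡ S + n * u + d * u
      e₁ = solve-∀
      e₂ : ∀ i j k → i + j + k ≡ i + k + j
      e₂ = solve-∀
      e₃ : ∀ i u v m → i * u + v + m * u ≡ (i + m) * u + v
      e₃ = solve-∀
      e₄ : ∀ n d d′ u v → (n + (d + d′)) * u + v ≡ (n + d) * u + (d′ * u + v)
      e₄ = solve-∀
    by-colour : ∀ j → f y ≡ j → S ≡ c * T zero + b * T (suc zero)
    by-colour zero fy = count zero (suc zero) b c (λ ()) fy (col1 y fy) refl
    by-colour (suc zero) fy = trans
      (count (suc zero) zero c b (λ ()) fy (col2 y fy) (+-comm c b))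
      (+-comm (b * T (suc zero)) (c * T zero))

  F-colour1 : ∀ j → t j ≢ 0 → ∃ λ X → F X ≡ colour1
  F-colour1 j tj≢0 with y , fy≡j ← surj j
    with X , πX , τX ← surjective y (fromℕ< (≤-trans (n≢0⇒n>0 tj≢0) (t≤q j))) =
    X , threshold-< _ (tag X) (begin-strict
      toℕ (tag X)  ≡⟨ trans (cong toℕ τX) (toℕ-fromℕ< _) ⟩
      0            <⟨ n≢0⇒n>0 tj≢0 ⟩
      t j          ≡⟨ cong t (trans (cong f πX) fy≡j) ⟨
      t (f (project X)) ∎)
    where open ≤-Reasoning

  F-colour2 : ∀ j → t j ≢ q → ∃ λ X → F X ≡ colour2
  F-colour2 j tj≢q with y , fy≡j ← surj j
    -- Label `t j` is the first one not below the threshold.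
    with X , πX , τX ← surjective y (fromℕ< (≤∧≢⇒< (t≤q j) tj≢q)) =
    X , threshold-≮ _ (tag X) (≤⇒≯ (≤-reflexive
      (trans (cong t (trans (cong f πX) fy≡j)) (sym (trans (cong toℕ τX) (toℕ-fromℕ< _))))))

  F-isColouring : t zero + t (suc zero) ≢ 0 → t zero + t (suc zero) ≢ 2 * q →
    IsColouring N q (q * (b + c) ∸ (c * t zero + b * t (suc zero))) (c * t zero + b * t (suc zero)) F
  F-isColouring t≢0 t≢2q = record
    { surj = F-surj
    ; col1 = λ X FX → trans (nbrs-F colour2 X (λ FX′ → contradiction (trans (sym FX) FX′) λ ()))
        (trans (cong₂ (λ i j → c * i + b * j) (∑-threshold₂ q _ (t≤q zero)) (∑-threshold₂ q _ (t≤q (suc zero))))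
               (complement (t≤q zero) (t≤q (suc zero))))
    ; col2 = λ X FX → trans (nbrs-F colour1 X (λ FX′ → contradiction (trans (sym FX) FX′) λ ()))
        (cong₂ (λ i j → c * i + b * j) (∑-threshold₁ q _ (t≤q zero)) (∑-threshold₁ q _ (t≤q (suc zero))))
    }
    where
    complement : ∀ {t₁ t₂} → t₁ ≤ q → t₂ ≤ q →
      c * (q ∸ t₁) + b * (q ∸ t₂) ≡ q * (b + c) ∸ (c * t₁ + b * t₂)
    complement {t₁} {t₂} t₁≤q t₂≤q = begin
      c * (q ∸ t₁) + b * (q ∸ t₂)
        ≡⟨ m+n∸n≡m _ (c * t₁ + b * t₂) ⟨
      c * (q ∸ t₁) + b * (q ∸ t₂) + (c * t₁ + b * t₂) ∸ (c * t₁ + b * t₂)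
        ≡⟨ cong (_∸ (c * t₁ + b * t₂)) (trans (collect c b (q ∸ t₁) (q ∸ t₂) t₁ t₂)
             (trans (cong₂ (λ i j → c * i + b * j) (m∸n+n≡m t₁≤q) (m∸n+n≡m t₂≤q)) (factor c b q))) ⟩
      q * (b + c) ∸ (c * t₁ + b * t₂) ∎
      where
      open ≡-Reasoning
      collect : ∀ c b i j s t → c * i + b * j + (c * s + b * t) ≡ c * (i + s) + b * (j + t)
      collect = solve-∀
      factor : ∀ c b q → c * q + b * q ≡ q * (b + c)
      factor = solve-∀
    F-surj : ∀ k → ∃ λ X → F X ≡ k
    F-surj zero with t zero ℕ.≟ 0 | t (suc zero) ℕ.≟ 0
    ... | no t₁≢0 | _ = F-colour1 zero t₁≢0
    ... | yes _ | no t₂≢0 = F-colour1 (suc zero) t₂≢0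
    ... | yes t₁≡0 | yes t₂≡0 = contradiction (cong₂ _+_ t₁≡0 t₂≡0) t≢0
    F-surj (suc zero) with t zero ℕ.≟ q | t (suc zero) ℕ.≟ q
    ... | no t₁≢q | _ = F-colour2 zero t₁≢q
    ... | yes _ | no t₂≢q = F-colour2 (suc zero) t₂≢q
    ... | yes t₁≡q | yes t₂≡q = contradiction
      (trans (cong₂ _+_ t₁≡q t₂≡q) (cong (λ k → q + k) (sym (+-identityʳ q)))) t≢2q

-- Degenerate parameters and assembly.

another : ∀ {p} (s : Fin (2 + p)) → ∃ λ s₁ → s₁ ≢ s
another zero = suc zero , λ ()
another (suc s) = zero , λ ()

Vertex-1-unique : (x y : Vertex n 1) → x ≡ y
Vertex-1-unique [] [] = refl
Vertex-1-unique (zero ∷ x) (zero ∷ y) = cong (zero ∷_) (Vertex-1-unique x y)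

distinct-vertices : ∀ {b c} {f : Vertex n q → Fin 2} → IsColouring n q b c f →
  ¬ (∀ (x y : Vertex n q) → x ≡ y)
distinct-vertices {f = f} f-colouring eq
  with x , fx ← IsColouring.surj f-colouring zero | y , fy ← IsColouring.surj f-colouring (suc zero) =
  contradiction (trans (sym fx) (trans (cong f (eq x y)) fy)) λ ()

-- For q = 1 or n = 0 there is a single vertex, which cannot carry two colours; q = 0 forces t₁ + t₂
-- = 0. Otherwise q ≥ 2 supplies the second value that `πℓ-surjective` asks for, and n ≥ 1 the block
-- whose label is adjusted.
recolouring : ∀ q {C : Vertex (1 + q) q → Set} → IsPerfectCode (1 + q) q C →
  ∀ n b c (f : Vertex n q → Fin 2) → IsColouring n q b c f →
  ∀ m → n * q + m ≡ n + (b + c) →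
  ∀ t₁ t₂ → t₁ ≤ q → t₂ ≤ q → t₁ + t₂ ≢ 0 → t₁ + t₂ ≢ 2 * q →
  Σ (Vertex (n * q + m) q → Fin 2)
    (IsColouring (n * q + m) q (q * (b + c) ∸ (c * t₁ + b * t₂)) (c * t₁ + b * t₂))
recolouring 0 _ n b c f f-col m eq t₁ t₂ t₁≤0 t₂≤0 t≢0 t≢2q =
  contradiction (cong₂ _+_ (n≤0⇒n≡0 t₁≤0) (n≤0⇒n≡0 t₂≤0)) t≢0
recolouring 1 _ n b c f f-col m eq t₁ t₂ t₁≤q t₂≤q t≢0 t≢2q =
  contradiction Vertex-1-unique (distinct-vertices f-col)
recolouring (suc (suc p)) _ zero b c f f-col m eq t₁ t₂ t₁≤q t₂≤q t≢0 t≢2q =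
  contradiction (λ { [] [] → refl }) (distinct-vertices f-col)
recolouring q@(suc (suc p)) perfect (suc n) b c f f-col m eq t₁ t₂ t₁≤q t₂≤q t≢0 t≢2q =
  transport (perfectCode-graph perfect)
  where
  open TotallySymmetric (suc p)
  t : Fin 2 → ℕ
  t zero = t₁
  t (suc zero) = t₂
  t≤q : ∀ j → t j ≤ q
  t≤q zero = t₁≤q
  t≤q (suc zero) = t₂≤q
  Result : ℕ → Set
  Result N = Σ (Vertex N q → Fin 2)
    (IsColouring N q (q * (b + c) ∸ (c * t₁ + b * t₂)) (c * t₁ + b * t₂))
  transport : (∃₂ λ U Λ → ∀ v → lineSum (graph {q} {suc p} U Λ) v ≡ 1 + q * graph U Λ v) →
    Result (suc n * q + m)
  transport (U , Λ , lineSum-graph) = subst Result (size≡ (suc n)) (R.F , R.F-isColouring t≢0 t≢2q)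
    where
    module D = Decoding U Λ lineSum-graph
    module B = Blocks D.π D.ℓ (block-lineSum D.π D.ℓ D.fibre-count) _∗_ ∑-∗ˡ ∑-∗ʳ ∗-involutive ∗-comm zero m
    module R = Recolouring {m = m} f f-col (B.project (suc n)) (B.tag (suc n)) (B.lineSum-project (suc n))
      (B.project-tag-surjective (λ s l → D.πℓ-surjective s l (proj₂ (another s))) n) eq t t≤q
    size≡ : ∀ n → B.size n ≡ n * q + m
    size≡ zero = refl
    size≡ (suc n) = trans (cong (q +_) (size≡ n)) (sym (+-assoc q (n * q) m))

-- Integer arithmetic of the main eigenvalue.

import Data.Integer as ℤ
import Data.Integer.Properties as ℤ
import Data.Integer.Tactic.RingSolver as ℤ
open import Data.Integer using (+_) renaming (_≤_ to _≤ℤ_; _-_ to _-ℤ_; _*_ to _*ℤ_; 0ℤ to 0ℤ)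

length≡ : ∀ N n q b c → + N ≡ (+ q *ℤ + n) -ℤ mainEigenvalue n q b c → N ≡ n + (b + c)
length≡ N n q b c eq = ℤ.+-injective (trans eq (trans
  (identity (+ q) (+ n) (+ (b + c))) (sym (ℤ.pos-+ n (b + c)))))
  where
  identity : ∀ i j s → (i *ℤ j) -ℤ (j *ℤ (i -ℤ ℤ.1ℤ) -ℤ s) ≡ j ℤ.+ s
  identity = ℤ.solve-∀

-- Nonpositivity of λ means n (q - 1) ≤ b + c, which leaves -λ ≥ 0 coordinates outside the n blocks.
eigenvalue≤0⇒length : ∀ n q b c → mainEigenvalue n q b c ≤ℤ 0ℤ → n * q ≤ n + (b + c)
eigenvalue≤0⇒length n q b c λ≤0 = ℤ.drop‿+≤+ (begin
  + (n * q)                                   ≡⟨ ℤ.pos-* n q ⟩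
  + n *ℤ + q                                  ≡⟨ identity (+ n) (+ q) ⟩
  + n ℤ.+ + n *ℤ (+ q -ℤ ℤ.1ℤ)                ≤⟨ ℤ.+-monoʳ-≤ (+ n) (ℤ.i-j≤0⇒i≤j {+ n *ℤ (+ q -ℤ ℤ.1ℤ)} {+ (b + c)} λ≤0) ⟩
  + n ℤ.+ + (b + c)                           ≡⟨ ℤ.pos-+ n (b + c) ⟨
  + (n + (b + c))                             ∎)
  where
  open ℤ.≤-Reasoning
  identity : ∀ i j → i *ℤ j ≡ i ℤ.+ i *ℤ (j -ℤ ℤ.1ℤ)
  identity = ℤ.solve-∀

-- With s = b + c, the s further coordinates add s (q - 1), and the new parameters subtract q s in
-- place of s; the two changes cancel.
mainEigenvalue-preserved : ∀ n q b c b′ c′ → b′ + c′ ≡ q * (b + c) →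
  mainEigenvalue (n + (b + c)) q b′ c′ ≡ mainEigenvalue n q b c
mainEigenvalue-preserved n q b c b′ c′ eq = trans
  (cong₂ (λ i j → i *ℤ (+ q -ℤ ℤ.1ℤ) -ℤ j) (ℤ.pos-+ n (b + c)) (trans (cong +_ eq) (ℤ.pos-* q (b + c))))
  (identity (+ n) (+ q) (+ (b + c)))
  where
  identity : ∀ j i s → (j ℤ.+ s) *ℤ (i -ℤ ℤ.1ℤ) -ℤ i *ℤ s ≡ j *ℤ (i -ℤ ℤ.1ℤ) -ℤ s
  identity = ℤ.solve-∀

theorem6 : (q : ℕ) →
    (∃ λ (C : Vertex (q + 1) q → Set) → IsPerfectCode (q + 1) q C) →
    (n b c : ℕ) (f : Vertex n q → Fin 2) → IsColouring n q b c f →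
    mainEigenvalue n q b c ≤ℤ 0ℤ →
    (t₁ t₂ : ℕ) → t₁ ≤ q → t₂ ≤ q → t₁ + t₂ ≢ 0 → t₁ + t₂ ≢ 2 * q →
    (N : ℕ) → + N ≡ (+ q *ℤ + n) -ℤ mainEigenvalue n q b c →
    Σ (Vertex N q → Fin 2) λ F →
    IsColouring N q (q * (b + c) ∸ (c * t₁ + b * t₂)) (c * t₁ + b * t₂) F ×
    mainEigenvalue N q (q * (b + c) ∸ (c * t₁ + b * t₂)) (c * t₁ + b * t₂)
    ≡ mainEigenvalue n q b c
theorem6 q code n b c f f-col λ≤0 t₁ t₂ t₁≤q t₂≤q t≢0 t≢2q N N≡ =
  subst Result (trans length-eq (sym N≡n+b+c)) (proj₁ F , proj₂ F , eigenvalue)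
  where
  b′ = q * (b + c) ∸ (c * t₁ + b * t₂)
  c′ = c * t₁ + b * t₂
  extra = n + (b + c) ∸ n * q
  Result : ℕ → Set
  Result N = Σ (Vertex N q → Fin 2) λ F →
    IsColouring N q b′ c′ F × mainEigenvalue N q b′ c′ ≡ mainEigenvalue n q b c
  N≡n+b+c : N ≡ n + (b + c)
  N≡n+b+c = length≡ N n q b c N≡
  length-eq : n * q + extra ≡ n + (b + c)
  length-eq = m+[n∸m]≡n (eigenvalue≤0⇒length n q b c λ≤0)
  F : Σ (Vertex (n * q + extra) q → Fin 2) (IsColouring (n * q + extra) q b′ c′)
  F = recolouring q
    (proj₂ (subst (λ k → ∃ λ (C : Vertex k q → Set) → IsPerfectCode k q C) (+-comm q 1) code))
    n b c f f-col extra length-eq t₁ t₂ t₁≤q t₂≤q t≢0 t≢2q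
  -- This makes the truncated subtraction in `b′` exact, so that b′ + c′ = q (b + c).
  c′≤ : c′ ≤ q * (b + c)
  c′≤ = ≤-trans (+-mono-≤ (*-monoʳ-≤ c t₁≤q) (*-monoʳ-≤ b t₂≤q)) (≤-reflexive (factor c b q))
    where
    factor : ∀ c b q → c * q + b * q ≡ q * (b + c)
    factor = solve-∀
  eigenvalue : mainEigenvalue (n * q + extra) q b′ c′ ≡ mainEigenvalue n q b c
  eigenvalue = trans (cong (λ N → mainEigenvalue N q b′ c′) length-eq)
    (mainEigenvalue-preserved n q b c b′ c′ (m∸n+n≡m c′≤))
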